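{- Let $a,b\ge1$ and $n\ge 0$ be integers, and let $e^{a,b}_n$ denote the number of edges of the Horadam cube $\Pi^{a,b}_n$. Then $$e^{a,b}_n=\sum_{k=0}^n(-1)^{n-k}\left\lceil\frac{n+k}{2}\right\rceil\binom{\left\lfloor\frac{n+k}{2}\right\rfloor}{k}a^kb^{\left\lfloor\frac{n-k}{2}\right\rfloor}.$$
   Context: For integers $a,b\ge1$ and $n\ge 0$, $\mathcal S^{a,b}_n$ is the set of all strings of length $n$ over the alphabet $\{0,1,\dots,a+b-1\}$ in which every letter from $\{a,\dots,a+b-1\}$ appears only immediately after a letter $0$; $\mathcal S^{a,b}_0$ contains only the empty string. The Horadam cube $\Pi^{a,b}_n$ is the simple graph with vertex set $\mathcal S^{a,b}_n$ in which $x_1\cdots x_n$ and $y_1\cdots y_n$ are adjacent if and only if $\sum_{i=1}^n|x_i-y_i|=1$. -}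

module Defs where

open import Data.Fin.Base using (Fin; toℕ)
open import Data.Fin.Properties using (any?; all?)
open import Data.Integer.Base as ℤ using (ℤ; 0ℤ)
open import Data.List.Base
  using (List; []; _∷_; _++_; map; filter; foldr; length; upTo; allFin;
         cartesianProductWith)
open import Data.List.Membership.Propositional using (_∈_)
open import Data.List.Membership.Propositional.Properties
  using (∈-allFin; ∈-cartesianProductWith⁺; ∈-filter⁺; ∈-filter⁻)
open import Data.List.Relation.Unary.All using ([])
open import Data.List.Relation.Unary.AllPairs using ([]; _∷_)
open import Data.List.Relation.Unary.Any using (here)
open import Data.List.Relation.Unary.Unique.Propositional using (Unique)
open import Data.List.Relation.Unary.Unique.Propositional.Properties
  using (allFin⁺; cartesianProductWith⁺; filter⁺)
open import Data.Nat.Base using (ℕ; zero; suc; _+_; _≤_; ∣_-_∣)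
open import Data.Nat.Properties using (_≟_; _≤?_; ∣-∣-comm; ∣n-n∣≡0)
open import Data.Product.Base using (∃-syntax; _×_; _,_; proj₂)
open import Data.Vec.Base as Vec using (Vec; []; _∷_; lookup; zipWith)
open import Data.Vec.Properties using (∷-injective; zipWith-comm)
open import Function.Bundles using (_⇔_; mk⇔)
open import Relation.Binary.Core using (Rel)
open import Relation.Binary.Definitions
  using (Symmetric; Irreflexive) renaming (Decidable to Decidable₂)
open import Relation.Binary.PropositionalEquality
  using (_≡_; refl; sym; trans; cong; cong₂)
open import Relation.Nullary.Decidable using (_×-dec_; _→-dec_)
open import Relation.Unary using (Pred; Decidable)

-- A finite simple graph whose vertex set is the subset IsVertex of an ambient
-- type V.  The list `vertices` enumerates that subset without repetition.

record FiniteSimpleGraph : Set₁ where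
  infix 4 _~_ _~?_
  field
    V          : Set
    IsVertex   : Pred V _
    _~_        : Rel V _
    ~-sym      : Symmetric _~_
    ~-irrefl   : Irreflexive _≡_ _~_
    _~?_       : Decidable₂ _~_
    vertices   : List V
    unique     : Unique vertices
    ∈-vertices : ∀ x → x ∈ vertices ⇔ IsVertex x

-- For a list without repetitions, each 2-element subset of its entries occurs
-- exactly once here, as a pair ordered by position in the list.

pairs : {A : Set} → List A → List (A × A)
pairs []       = []
pairs (x ∷ xs) = map (x ,_) xs ++ pairs xs

module _ (G : FiniteSimpleGraph) where
  open FiniteSimpleGraph G

  edges : List (V × V)
  edges = filter (λ (x , y) → x ~? y) (pairs vertices)

  numberOfEdges : ℕ
  numberOfEdges = length edges

Word : ℕ → ℕ → Set
Word m n = Vec (Fin m) n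

words : ∀ m n → List (Word m n)
words m zero    = [] ∷ []
words m (suc n) = cartesianProductWith _∷_ (allFin m) (words m n)

words-unique : ∀ m n → Unique (words m n)
words-unique m zero    = [] ∷ []
words-unique m (suc n) =
  cartesianProductWith⁺ _∷_ ∷-injective (allFin⁺ m) (words-unique m n)

∈-words : ∀ {m n} (x : Word m n) → x ∈ words m n
∈-words []       = here refl
∈-words (c ∷ cs) = ∈-cartesianProductWith⁺ _∷_ (∈-allFin c) (∈-words cs)

distance : ∀ {m n} → Word m n → Word m n → ℕ
distance x y = Vec.sum (zipWith (λ c d → ∣ toℕ c - toℕ d ∣) x y)

distance-comm : ∀ {m n} (x y : Word m n) → distance x y ≡ distance y x
distance-comm x y =
  cong Vec.sum (zipWith-comm (λ c d → ∣-∣-comm (toℕ c) (toℕ d)) x y)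

distance-self : ∀ {m n} (x : Word m n) → distance x x ≡ 0
distance-self []       = refl
distance-self (c ∷ cs) = cong₂ _+_ (∣n-n∣≡0 (toℕ c)) (distance-self cs)

module _ (a b n : ℕ) where

  -- Position i is immediately preceded by position j, which carries letter 0.
  IsHoradam : Pred (Word (a + b) n) _
  IsHoradam x = ∀ i → a ≤ toℕ (lookup x i) →
    ∃[ j ] (suc (toℕ j) ≡ toℕ i × toℕ (lookup x j) ≡ 0)

  isHoradam? : Decidable IsHoradam
  isHoradam? x = all? λ i → (a ≤? toℕ (lookup x i)) →-dec
    any? λ j → (suc (toℕ j) ≟ toℕ i) ×-dec (toℕ (lookup x j) ≟ 0)

  horadamCube : FiniteSimpleGraph
  horadamCube = record
    { V          = Word (a + b) n
    ; IsVertex   = IsHoradam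
    ; _~_        = λ x y → distance x y ≡ 1
    ; ~-sym      = λ {x} {y} d≡1 → trans (distance-comm y x) d≡1
    ; ~-irrefl   = irrefl
    ; _~?_       = λ x y → distance x y ≟ 1
    ; vertices   = filter isHoradam? (words (a + b) n)
    ; unique     = filter⁺ isHoradam? (words-unique (a + b) n)
    ; ∈-vertices = λ x → mk⇔
        (λ x∈ → proj₂ (∈-filter⁻ isHoradam? {xs = words (a + b) n} x∈))
        (∈-filter⁺ isHoradam? (∈-words x))
    }
    where
    irrefl : Irreflexive _≡_ (λ x y → distance x y ≡ 1)
    irrefl {x} refl d≡1 with () ← trans (sym (distance-self x)) d≡1

-- ∑[0⋯ n ] f = f 0 + f 1 + ⋯ + f n, both end points included.

∑[0⋯_] : ℕ → (ℕ → ℤ) → ℤ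
∑[0⋯ n ] f = foldr ℤ._+_ 0ℤ (map f (upTo (suc n)))

{-# OPTIONS --safe #-}

-- Let Sₙ be the set of Horadam words of length n and Tₙ ⊇ Sₙ the set of words
-- x such that 0x is Horadam.  Splitting by the first letter,
--   Sₙ₊₁ = 0Tₙ ∪ 1Sₙ ∪ ⋯ ∪ (a−1)Sₙ,   Tₙ₊₁ = 0Tₙ ∪ 1Sₙ ∪ ⋯ ∪ (a+b−1)Sₙ.
-- An edge either lies inside one block or joins equal tails in two consecutive
-- blocks, and |Tₙ ∩ Sₙ| = |Sₙ|; eliminating T, with s = |S| and e the number of
-- edges,
--   sₙ₊₂ = a sₙ₊₁ + b sₙ,   eₙ₊₂ = a eₙ₊₁ + b eₙ + sₙ₊₂ − sₙ₊₁.
-- On the other side put d = n − k, so that the sum runs over the antidiagonal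
-- d + k = n, and let Gₙ be the same sum without the factor ⌈(n+k)/2⌉.  By
-- Pascal's rule the terms of Gₙ₊₂ are those of a Gₙ₊₁ shifted in k plus those
-- of b Gₙ shifted twice in d, so Gₙ₊₂ = a Gₙ₊₁ + b Gₙ and Gₙ₊₁ = sₙ₊₁ − sₙ.
-- The factor is ⌈d/2⌉ + k, which both shifts raise by one, so the sum F of the
-- theorem satisfies Fₙ₊₂ = a Fₙ₊₁ + b Fₙ + Gₙ₊₂, the recurrence of e.

module Submission where

open import Defs
open import Algebra.Bundles using (AbelianGroup)
open import Algebra.Properties.Group using (∙-cancelʳ)
open import Data.Bool.Base using (true; false)
open import Data.Fin.Base using (Fin; zero; suc; toℕ)
open import Data.Fin.Properties using (toℕ-injective; toℕ<n)
open import Data.Integer.Base as ℤ using (ℤ; +_; -1ℤ; 0ℤ; 1ℤ)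
import Data.Integer.Properties as ℤₚ
open import Data.Integer.Tactic.RingSolver using (solve-∀)
open import Data.List.Base
  using (List; []; _∷_; _++_; map; filter; foldr; length; tabulate; cartesianProductWith)
open import Data.List.Membership.Propositional using (_∈_)
open import Data.List.Membership.Propositional.Properties using (∈-filter⁺; ∈-filter⁻)
open import Data.List.Properties
  using (filter-++; filter-≐; filter-none; filter-accept; filter-reject; length-++; length-map;
         map-++; map-cong; map-∘; map-upTo)
open import Data.List.Relation.Unary.All as All using (All; []; _∷_)
open import Data.List.Relation.Unary.AllPairs using ([]; _∷_)
open import Data.List.Relation.Unary.Any using (here; there)
open import Data.List.Relation.Unary.Unique.Propositional using (Unique)
open import Data.List.Relation.Unary.Unique.Propositional.Properties using (filter⁺)
open import Data.Nat.Base
open import Data.Nat.Combinatorics using (_C_; nCn≡1; nCk+nC[k+1]≡[n+1]C[k+1])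
open import Data.Nat.ListAction using (sum)
open import Data.Nat.ListAction.Properties using (sum-++)
open import Data.Nat.Properties
import Data.Nat.Tactic.RingSolver as ℕ-Solver
open import Data.Product.Base using (_,_)
open import Data.Vec.Base using ([]; _∷_)
open import Function.Base using (_∘_; id)
open import Level using (0ℓ)
open import Relation.Binary.PropositionalEquality
open import Relation.Nullary.Decidable using (does)
open import Relation.Nullary.Negation using (contradiction; ¬_)
open import Relation.Unary using (Pred; Decidable; _⊆_; _≐_)
open import Algebra.Properties.CommutativeSemigroup +-commutativeSemigroup using (x∙yz≈y∙xz)

-- Sums over antidiagonals

∑-suc : ∀ n (f : ℕ → ℤ) → ∑[0⋯ suc n ] f ≡ f 0 ℤ.+ ∑[0⋯ n ] (f ∘ suc)
∑-suc n f = trans (cong (foldr ℤ._+_ 0ℤ) (map-upTo f (2 + n)))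
  (cong (λ xs → f 0 ℤ.+ foldr ℤ._+_ 0ℤ xs) (sym (map-upTo (f ∘ suc) (suc n))))

∑-cong : ∀ n {f g : ℕ → ℤ} → (∀ k → k ≤ n → f k ≡ g k) → ∑[0⋯ n ] f ≡ ∑[0⋯ n ] g
∑-cong zero    f≗g = cong (ℤ._+ 0ℤ) (f≗g 0 z≤n)
∑-cong (suc n) {f} {g} f≗g = trans (∑-suc n f) (trans
  (cong₂ ℤ._+_ (f≗g 0 z≤n) (∑-cong n λ k k≤n → f≗g (suc k) (s≤s k≤n)))
  (sym (∑-suc n g)))

-- Peels off the term with `k = 0` and moves the shift in `k` into `h`. Inductions on `n` then run
-- with `h` varying, and no truncated subtraction occurs.
antidiagonal : (ℕ → ℕ → ℤ) → ℕ → ℤ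
antidiagonal h zero    = h 0 0
antidiagonal h (suc n) = h (suc n) 0 ℤ.+ antidiagonal (λ d k → h d (suc k)) n

∑-antidiagonal : ∀ n h → ∑[0⋯ n ] (λ k → h (n ∸ k) k) ≡ antidiagonal h n
∑-antidiagonal zero    h = ℤₚ.+-identityʳ (h 0 0)
∑-antidiagonal (suc n) h = trans (∑-suc n (λ k → h (suc n ∸ k) k))
  (cong (ℤ._+_ (h (suc n) 0)) (∑-antidiagonal n (λ d k → h d (suc k))))

antidiagonal-cong : ∀ n {h h′} → (∀ d k → d + k ≡ n → h d k ≡ h′ d k) →
  antidiagonal h n ≡ antidiagonal h′ n
antidiagonal-cong zero    h≗h′ = h≗h′ 0 0 refl
antidiagonal-cong (suc n) h≗h′ = cong₂ ℤ._+_ (h≗h′ (suc n) 0 (+-identityʳ _))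
  (antidiagonal-cong n λ d k d+k≡n → h≗h′ d (suc k) (trans (+-suc d k) (cong suc d+k≡n)))

antidiagonal-+ : ∀ n h h′ →
  antidiagonal (λ d k → h d k ℤ.+ h′ d k) n ≡ antidiagonal h n ℤ.+ antidiagonal h′ n
antidiagonal-+ zero    h h′ = refl
antidiagonal-+ (suc n) h h′
  rewrite antidiagonal-+ n (λ d k → h d (suc k)) (λ d k → h′ d (suc k)) =
  interchange (h (suc n) 0) (h′ (suc n) 0) _ _
  where
  interchange : ∀ x y z w → (x ℤ.+ y) ℤ.+ (z ℤ.+ w) ≡ (x ℤ.+ z) ℤ.+ (y ℤ.+ w)
  interchange = solve-∀

antidiagonal-* : ∀ n c h → antidiagonal (λ d k → c ℤ.* h d k) n ≡ c ℤ.* antidiagonal h n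
antidiagonal-* zero    c h = refl
antidiagonal-* (suc n) c h
  rewrite antidiagonal-* n c (λ d k → h d (suc k)) = sym (ℤₚ.*-distribˡ-+ c _ _)

-- Multiplication by one of the two variables in the generating function of `h`. The value 0 on the
-- boundary lets a single recurrence cover the boundary terms too.
shift₁ shift₂ : (ℕ → ℕ → ℤ) → ℕ → ℕ → ℤ
shift₁ h zero    k = 0ℤ
shift₁ h (suc d) k = h d k
shift₂ h d zero    = 0ℤ
shift₂ h d (suc k) = h d k

-- The vanishing term `d = 0` is the last one that `antidiagonal` reaches, hence the induction; for
-- `shift₂` the vanishing term `k = 0` comes first.
antidiagonal-shift₁ : ∀ n h → antidiagonal (shift₁ h) (suc n) ≡ antidiagonal h n
antidiagonal-shift₁ zero    h = ℤₚ.+-identityʳ (h 0 0)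
antidiagonal-shift₁ (suc n) h = cong (ℤ._+_ (h (suc n) 0))
  (trans (antidiagonal-cong (suc n) shift₁-suc) (antidiagonal-shift₁ n (λ d k → h d (suc k))))
  where
  shift₁-suc : ∀ d k → d + k ≡ suc n →
    shift₁ h d (suc k) ≡ shift₁ (λ d k → h d (suc k)) d k
  shift₁-suc zero    k _ = refl
  shift₁-suc (suc d) k _ = refl

antidiagonal-shift₂ : ∀ n h → antidiagonal (shift₂ h) (suc n) ≡ antidiagonal h n
antidiagonal-shift₂ n h = ℤₚ.+-identityˡ _

-- Lifts a recurrence of coefficients to their antidiagonal sums: `shift₂` lowers `d + k` by one,
-- the double `shift₁` by two. The inhomogeneous term `u` will be 0 for `G` and `signed` for `F`.
antidiagonal-recurrence : ∀ α β n {h u : ℕ → ℕ → ℤ} →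
  (∀ d k → d + k ≡ 2 + n →
    h d k ≡ α ℤ.* shift₂ h d k ℤ.+ β ℤ.* shift₁ (shift₁ h) d k ℤ.+ u d k) →
  antidiagonal h (2 + n) ≡
    α ℤ.* antidiagonal h (1 + n) ℤ.+ β ℤ.* antidiagonal h n ℤ.+ antidiagonal u (2 + n)
antidiagonal-recurrence α β n {h} {u} rec = begin
  A h (2 + n)
    ≡⟨ antidiagonal-cong (2 + n) rec ⟩
  A (λ d k → α ℤ.* x d k ℤ.+ β ℤ.* y d k ℤ.+ u d k) (2 + n)
    ≡⟨ antidiagonal-+ (2 + n) (λ d k → α ℤ.* x d k ℤ.+ β ℤ.* y d k) u ⟩
  A (λ d k → α ℤ.* x d k ℤ.+ β ℤ.* y d k) (2 + n) ℤ.+ U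
    ≡⟨ cong (ℤ._+ U) (antidiagonal-+ (2 + n) (λ d k → α ℤ.* x d k) (λ d k → β ℤ.* y d k)) ⟩
  A (λ d k → α ℤ.* x d k) (2 + n) ℤ.+ A (λ d k → β ℤ.* y d k) (2 + n) ℤ.+ U
    ≡⟨ cong (ℤ._+ U) (cong₂ ℤ._+_ (antidiagonal-* (2 + n) α x) (antidiagonal-* (2 + n) β y)) ⟩
  α ℤ.* A x (2 + n) ℤ.+ β ℤ.* A y (2 + n) ℤ.+ U
    ≡⟨ cong (ℤ._+ U) (cong₂ (λ v w → α ℤ.* v ℤ.+ β ℤ.* w)
         (antidiagonal-shift₂ (1 + n) h)
         (trans (antidiagonal-shift₁ (1 + n) (shift₁ h)) (antidiagonal-shift₁ n h))) ⟩
  α ℤ.* A h (1 + n) ℤ.+ β ℤ.* A h n ℤ.+ U ∎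
  where
  open ≡-Reasoning
  A = antidiagonal
  x = shift₂ h
  y = shift₁ (shift₁ h)
  U = A u (2 + n)

-- Coefficients of the closed formula and their recurrences

⌊m+n+n/2⌋≡⌊m/2⌋+n : ∀ m n → ⌊ m + n + n /2⌋ ≡ ⌊ m /2⌋ + n
⌊m+n+n/2⌋≡⌊m/2⌋+n m zero    = trans
  (cong ⌊_/2⌋ (trans (+-identityʳ (m + 0)) (+-identityʳ m))) (sym (+-identityʳ ⌊ m /2⌋))
⌊m+n+n/2⌋≡⌊m/2⌋+n m (suc n) = begin
  ⌊ m + suc n + suc n /2⌋ ≡⟨ cong ⌊_/2⌋ (+-suc (m + suc n) n) ⟩
  ⌈ m + suc n + n /2⌉     ≡⟨ cong (λ x → ⌈ x + n /2⌉) (+-suc m n) ⟩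
  suc ⌊ m + n + n /2⌋     ≡⟨ cong suc (⌊m+n+n/2⌋≡⌊m/2⌋+n m n) ⟩
  suc (⌊ m /2⌋ + n)       ≡⟨ +-suc ⌊ m /2⌋ n ⟨
  ⌊ m /2⌋ + suc n         ∎
  where open ≡-Reasoning

module Coefficients (a b : ℕ) where

  -- With `d = n ∸ k`, half of `n + k` rounds down to `⌊ d /2⌋ + k` and up to `weight d k`, so the
  -- summand depends on `d` and `k` alone.
  monomial : ℕ → ℕ → ℕ
  monomial d k = ((⌊ d /2⌋ + k) C k) * a ^ k * b ^ ⌊ d /2⌋

  weight : ℕ → ℕ → ℕ
  weight d k = ⌈ d /2⌉ + k

  signed weighted : ℕ → ℕ → ℤ
  signed   d k = -1ℤ ℤ.^ d ℤ.* + monomial d k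
  weighted d k = + weight d k ℤ.* signed d k

  monomial-d0 : ∀ d → monomial (2 + d) 0 ≡ b * monomial d 0
  monomial-d0 d = rearrange b (b ^ ⌊ d /2⌋)
    where
    rearrange : ∀ y z → 1 * 1 * (y * z) ≡ y * (1 * 1 * z)
    rearrange = ℕ-Solver.solve-∀

  -- Covers the columns `d = 0` and `d = 1`, where the binomial coefficients on both sides equal 1
  -- and only the power of `a` grows.
  monomial-nC : ∀ d k → ⌊ d /2⌋ ≡ 0 → monomial d (suc k) ≡ a * monomial d k
  monomial-nC d k ⌊d/2⌋≡0 rewrite ⌊d/2⌋≡0 | nCn≡1 k | nCn≡1 (suc k) =
    rearrange a (a ^ k)
    where
    rearrange : ∀ x z → 1 * (x * z) * 1 ≡ x * (1 * z * 1)
    rearrange = ℕ-Solver.solve-∀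

  -- In Pascal's rule one summand lowers `k` and gives up a factor `a`; the other lowers `⌊ d /2⌋`
  -- and gives up a factor `b`.
  monomial-pascal : ∀ d k →
    monomial (2 + d) (suc k) ≡ a * monomial (2 + d) k + b * monomial d (suc k)
  monomial-pascal d k
    rewrite sym (nCk+nC[k+1]≡[n+1]C[k+1] (⌊ d /2⌋ + suc k) k) | +-suc ⌊ d /2⌋ k =
    distribute a b ((suc (⌊ d /2⌋ + k)) C k) ((suc (⌊ d /2⌋ + k)) C suc k) (a ^ k) (b ^ ⌊ d /2⌋)
    where
    distribute : ∀ a b c c′ x y →
      (c + c′) * (a * x) * (b * y) ≡ a * (c * x * (b * y)) + b * (c′ * (a * x) * y)
    distribute = ℕ-Solver.solve-∀

  -- The shifts change `d` by 0 or 2, so the sign never changes. The condition on `d + k` excludes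
  -- (0,0) and (1,0), where the left side is 1 or -1 but both shifted terms vanish. The final `0ℤ`
  -- plays the part of `u` in `antidiagonal-recurrence`.
  signed-recurrence : ∀ n d k → d + k ≡ 2 + n → signed d k ≡
    + a ℤ.* shift₂ signed d k ℤ.+ + b ℤ.* shift₁ (shift₁ signed) d k ℤ.+ 0ℤ
  signed-recurrence n zero (suc k) _ = begin
    1ℤ ℤ.* + monomial 0 (suc k) ≡⟨ cong (λ x → 1ℤ ℤ.* + x) (monomial-nC 0 k refl) ⟩
    1ℤ ℤ.* + (a * monomial 0 k) ≡⟨ cong (ℤ._*_ 1ℤ) (ℤₚ.pos-* a (monomial 0 k)) ⟩
    1ℤ ℤ.* (+ a ℤ.* + monomial 0 k) ≡⟨ move (+ a) (+ monomial 0 k) (+ b) ⟩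
    _ ∎
    where
    open ≡-Reasoning
    move : ∀ x y z → 1ℤ ℤ.* (x ℤ.* y) ≡ x ℤ.* (1ℤ ℤ.* y) ℤ.+ z ℤ.* 0ℤ ℤ.+ 0ℤ
    move = solve-∀
  signed-recurrence n (suc zero) (suc k) _ = begin
    -1ℤ ℤ.* + monomial 1 (suc k) ≡⟨ cong (λ x → -1ℤ ℤ.* + x) (monomial-nC 1 k refl) ⟩
    -1ℤ ℤ.* + (a * monomial 1 k) ≡⟨ cong (ℤ._*_ -1ℤ) (ℤₚ.pos-* a (monomial 1 k)) ⟩
    -1ℤ ℤ.* (+ a ℤ.* + monomial 1 k) ≡⟨ move (+ a) (+ monomial 1 k) (+ b) ⟩
    _ ∎
    where
    open ≡-Reasoning
    move : ∀ x y z → -1ℤ ℤ.* (x ℤ.* y) ≡ x ℤ.* (-1ℤ ℤ.* y) ℤ.+ z ℤ.* 0ℤ ℤ.+ 0ℤ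
    move = solve-∀
  signed-recurrence n (suc (suc d)) zero _ = begin
    σ ℤ.* + monomial (2 + d) 0       ≡⟨ cong (λ x → σ ℤ.* + x) (monomial-d0 d) ⟩
    σ ℤ.* + (b * monomial d 0)       ≡⟨ cong (ℤ._*_ σ) (ℤₚ.pos-* b (monomial d 0)) ⟩
    σ ℤ.* (+ b ℤ.* + monomial d 0)   ≡⟨ move (+ a) (+ b) (-1ℤ ℤ.^ d) (+ monomial d 0) ⟩
    _ ∎
    where
    open ≡-Reasoning
    σ = -1ℤ ℤ.^ (2 + d)
    move : ∀ x y z w → -1ℤ ℤ.* (-1ℤ ℤ.* z) ℤ.* (y ℤ.* w) ≡ x ℤ.* 0ℤ ℤ.+ y ℤ.* (z ℤ.* w) ℤ.+ 0ℤ
    move = solve-∀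
  signed-recurrence n (suc (suc d)) (suc k) _ = begin
    σ ℤ.* + monomial (2 + d) (suc k)
      ≡⟨ cong (λ x → σ ℤ.* + x) (monomial-pascal d k) ⟩
    σ ℤ.* + (a * monomial (2 + d) k + b * monomial d (suc k))
      ≡⟨ cong (ℤ._*_ σ) (trans (ℤₚ.pos-+ (a * monomial (2 + d) k) _)
           (cong₂ ℤ._+_ (ℤₚ.pos-* a _) (ℤₚ.pos-* b _))) ⟩
    σ ℤ.* (+ a ℤ.* + monomial (2 + d) k ℤ.+ + b ℤ.* + monomial d (suc k))
      ≡⟨ move (+ a) (+ b) (-1ℤ ℤ.^ d) (+ monomial (2 + d) k) (+ monomial d (suc k)) ⟩
    _ ∎
    where
    open ≡-Reasoning
    σ = -1ℤ ℤ.^ (2 + d)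
    move : ∀ x y z v w → -1ℤ ℤ.* (-1ℤ ℤ.* z) ℤ.* (x ℤ.* v ℤ.+ y ℤ.* w) ≡
      x ℤ.* (-1ℤ ℤ.* (-1ℤ ℤ.* z) ℤ.* v) ℤ.+ y ℤ.* (z ℤ.* w) ℤ.+ 0ℤ
    move = solve-∀

  -- Lowering `k` by one, or `d` by two as in the next lemma, lowers the weight by exactly one; on
  -- the boundary both sides are 0 whatever the weight.
  shift₂-weighted : ∀ d k w → weight d k ≡ suc w →
    shift₂ weighted d k ≡ + w ℤ.* shift₂ signed d k
  shift₂-weighted d zero    w _        = sym (ℤₚ.*-zeroʳ (+ w))
  shift₂-weighted d (suc k) w weight≡w = cong (λ v → + v ℤ.* signed d k)
    (suc-injective (trans (sym (+-suc ⌈ d /2⌉ k)) weight≡w))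

  shift₁²-weighted : ∀ d k w → weight d k ≡ suc w →
    shift₁ (shift₁ weighted) d k ≡ + w ℤ.* shift₁ (shift₁ signed) d k
  shift₁²-weighted zero          k w _        = sym (ℤₚ.*-zeroʳ (+ w))
  shift₁²-weighted (suc zero)    k w _        = sym (ℤₚ.*-zeroʳ (+ w))
  shift₁²-weighted (suc (suc d)) k w weight≡w =
    cong (λ v → + v ℤ.* signed d k) (suc-injective weight≡w)

  weight-positive : ∀ n d k → d + k ≡ suc n → weight d k ≡ suc (pred (weight d k))
  weight-positive n zero    (suc k) _ = refl
  weight-positive n (suc d) k       _ = refl

  -- Of the `1 + w` copies of `signed d k`, `w` are expanded by the recurrence and supply the
  -- weights of the shifted terms; the remaining copy becomes the inhomogeneous term.
  weighted-recurrence : ∀ n d k → d + k ≡ 2 + n → weighted d k ≡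
    + a ℤ.* shift₂ weighted d k ℤ.+ + b ℤ.* shift₁ (shift₁ weighted) d k ℤ.+ signed d k
  weighted-recurrence n d k d+k≡2+n = begin
    + weight d k ℤ.* s                   ≡⟨ cong (λ v → + v ℤ.* s) weight≡1+w ⟩
    (1ℤ ℤ.+ + w) ℤ.* s                   ≡⟨ expand s (+ w) ⟩
    + w ℤ.* s ℤ.+ s                      ≡⟨ cong (λ t → + w ℤ.* t ℤ.+ s) (signed-recurrence n d k d+k≡2+n) ⟩
    + w ℤ.* (+ a ℤ.* x ℤ.+ + b ℤ.* y ℤ.+ 0ℤ) ℤ.+ s
                                         ≡⟨ distribute (+ a) (+ b) (+ w) x y s ⟩
    + a ℤ.* (+ w ℤ.* x) ℤ.+ + b ℤ.* (+ w ℤ.* y) ℤ.+ s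
                                         ≡⟨ cong₂ (λ x y → + a ℤ.* x ℤ.+ + b ℤ.* y ℤ.+ s)
                                              (shift₂-weighted d k w weight≡1+w)
                                              (shift₁²-weighted d k w weight≡1+w) ⟨
    + a ℤ.* shift₂ weighted d k ℤ.+ + b ℤ.* shift₁ (shift₁ weighted) d k ℤ.+ s ∎
    where
    open ≡-Reasoning
    w = pred (weight d k)
    weight≡1+w = weight-positive (suc n) d k d+k≡2+n
    s = signed d k
    x = shift₂ signed d k
    y = shift₁ (shift₁ signed) d k
    expand : ∀ s w → (1ℤ ℤ.+ w) ℤ.* s ≡ w ℤ.* s ℤ.+ s
    expand = solve-∀
    distribute : ∀ a b w x y s → w ℤ.* (a ℤ.* x ℤ.+ b ℤ.* y ℤ.+ 0ℤ) ℤ.+ s ≡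
      a ℤ.* (w ℤ.* x) ℤ.+ b ℤ.* (w ℤ.* y) ℤ.+ s
    distribute = solve-∀

  F G : ℕ → ℤ
  F = antidiagonal weighted
  G = antidiagonal signed

  antidiagonal-0 : ∀ n → antidiagonal (λ _ _ → 0ℤ) n ≡ 0ℤ
  antidiagonal-0 zero    = refl
  antidiagonal-0 (suc n) = trans (ℤₚ.+-identityˡ _) (antidiagonal-0 n)

  G₁ : G 1 ≡ -1ℤ ℤ.+ + a
  G₁ = cong (ℤ._+_ -1ℤ) (trans (ℤₚ.*-identityˡ (+ monomial 0 1)) (cong +_ (simplify a)))
    where
    simplify : ∀ x → 1 * (x * 1) * 1 ≡ x
    simplify = ℕ-Solver.solve-∀

  G-recurrence : ∀ n → G (2 + n) ≡ + a ℤ.* G (1 + n) ℤ.+ + b ℤ.* G n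
  G-recurrence n = trans (antidiagonal-recurrence (+ a) (+ b) n (signed-recurrence n))
    (trans (cong (ℤ._+_ (+ a ℤ.* G (1 + n) ℤ.+ + b ℤ.* G n)) (antidiagonal-0 (2 + n)))
      (ℤₚ.+-identityʳ _))

  F-recurrence : ∀ n → F (2 + n) ≡ + a ℤ.* F (1 + n) ℤ.+ + b ℤ.* F n ℤ.+ G (2 + n)
  F-recurrence n = antidiagonal-recurrence (+ a) (+ b) n (weighted-recurrence n)

  ∑≡F : ∀ n → ∑[0⋯ n ] (λ k → (-1ℤ ℤ.^ (n ∸ k)) ℤ.*
    (+ (⌈ n + k /2⌉ * (⌊ n + k /2⌋ C k) * a ^ k * b ^ ⌊ n ∸ k /2⌋))) ≡ F n
  ∑≡F n = trans (∑-cong n term) (∑-antidiagonal n weighted)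
    where
    open ≡-Reasoning
    term : ∀ k → k ≤ n → (-1ℤ ℤ.^ (n ∸ k)) ℤ.*
      (+ (⌈ n + k /2⌉ * (⌊ n + k /2⌋ C k) * a ^ k * b ^ ⌊ n ∸ k /2⌋)) ≡ weighted (n ∸ k) k
    term k k≤n = begin
      σ ℤ.* + (⌈ n + k /2⌉ * (⌊ n + k /2⌋ C k) * a ^ k * b ^ ⌊ d /2⌋)
        ≡⟨ cong₂ (λ u v → σ ℤ.* + (u * (v C k) * a ^ k * b ^ ⌊ d /2⌋)) ⌈n+k/2⌉ ⌊n+k/2⌋ ⟩
      σ ℤ.* + (weight d k * ((⌊ d /2⌋ + k) C k) * a ^ k * b ^ ⌊ d /2⌋)
        ≡⟨ cong (λ v → σ ℤ.* + v) (assoc (weight d k) _ (a ^ k) (b ^ ⌊ d /2⌋)) ⟩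
      σ ℤ.* + (weight d k * monomial d k)
        ≡⟨ cong (ℤ._*_ σ) (ℤₚ.pos-* (weight d k) _) ⟩
      σ ℤ.* (+ weight d k ℤ.* + monomial d k)
        ≡⟨ swap σ (+ weight d k) (+ monomial d k) ⟩
      weighted d k ∎
      where
      d = n ∸ k
      σ = -1ℤ ℤ.^ d
      n+k≡d+k+k : n + k ≡ d + k + k
      n+k≡d+k+k = cong (_+ k) (sym (m∸n+n≡m k≤n))
      ⌊n+k/2⌋ : ⌊ n + k /2⌋ ≡ ⌊ d /2⌋ + k
      ⌊n+k/2⌋ = trans (cong ⌊_/2⌋ n+k≡d+k+k) (⌊m+n+n/2⌋≡⌊m/2⌋+n d k)
      ⌈n+k/2⌉ : ⌈ n + k /2⌉ ≡ ⌈ d /2⌉ + k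
      -- Rounding up is by definition rounding down the half of the successor, so the same lemma
      -- applies at `suc d`.
      ⌈n+k/2⌉ = trans (cong ⌈_/2⌉ n+k≡d+k+k) (⌊m+n+n/2⌋≡⌊m/2⌋+n (suc d) k)
      assoc : ∀ w c x y → w * c * x * y ≡ w * (c * x * y)
      assoc = ℕ-Solver.solve-∀
      swap : ∀ x y z → x ℤ.* (y ℤ.* z) ≡ y ℤ.* (x ℤ.* z)
      swap = solve-∀

  -- Comparing the closed formula with solutions of the vertex and edge recurrences

  module _ (s e : ℕ → ℕ)
    (s₀ : s 0 ≡ 1) (s₁ : s 1 ≡ a) (e₀ : e 0 ≡ 0) (e₁ : 1 + e 1 ≡ a)
    (s₂₊ : ∀ n → s (2 + n) ≡ a * s (1 + n) + b * s n)
    (e₂₊ : ∀ n → e (2 + n) + s (1 + n) ≡ a * e (1 + n) + b * e n + s (2 + n))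
    where

    s₂₊ℤ : ∀ n → + s (2 + n) ≡ + a ℤ.* + s (1 + n) ℤ.+ + b ℤ.* + s n
    s₂₊ℤ n = trans (cong +_ (s₂₊ n)) (trans (ℤₚ.pos-+ (a * s (1 + n)) _)
      (cong₂ ℤ._+_ (ℤₚ.pos-* a _) (ℤₚ.pos-* b _)))

    e₂₊ℤ : ∀ n → + e (2 + n) ℤ.+ + s (1 + n) ≡
      + a ℤ.* + e (1 + n) ℤ.+ + b ℤ.* + e n ℤ.+ + s (2 + n)
    e₂₊ℤ n = trans (sym (ℤₚ.pos-+ (e (2 + n)) _)) (trans (cong +_ (e₂₊ n))
      (trans (ℤₚ.pos-+ (a * e (1 + n) + b * e n) _) (cong (ℤ._+ (+ s (2 + n)))
        (trans (ℤₚ.pos-+ (a * e (1 + n)) _) (cong₂ ℤ._+_ (ℤₚ.pos-* a _) (ℤₚ.pos-* b _))))))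

    +-cancel : ∀ x y z → y ℤ.+ x ≡ z ℤ.+ x → y ≡ z
    +-cancel = ∙-cancelʳ (AbelianGroup.group ℤₚ.+-0-abelianGroup)

    -- `G` obeys the recurrence of `s`, hence also that of its differences; the additive form stays
    -- free of subtraction.
    G-value : ∀ n → G (1 + n) ℤ.+ + s n ≡ + s (1 + n)
    G-value zero = begin
      G 1 ℤ.+ + s 0           ≡⟨ cong₂ (λ x y → x ℤ.+ + y) G₁ s₀ ⟩
      -1ℤ ℤ.+ + a ℤ.+ 1ℤ      ≡⟨ cancel (+ a) ⟩
      + a                     ≡⟨ cong +_ s₁ ⟨
      + s 1                   ∎
      where
      open ≡-Reasoning
      cancel : ∀ x → -1ℤ ℤ.+ x ℤ.+ 1ℤ ≡ x
      cancel = solve-∀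
    -- A separate base case, since the general step would need `s` at index -1. Here `G 0` computes
    -- to 1, and `s₁` acts as the recurrence with the value 0 at that index.
    G-value (suc zero) = begin
      G 2 ℤ.+ + s 1   ≡⟨ cong₂ (λ x y → x ℤ.+ + y) (G-recurrence 0) s₁ ⟩
      + a ℤ.* G 1 ℤ.+ + b ℤ.* 1ℤ ℤ.+ + a
                      ≡⟨ solve₁ (+ a) (+ b) (G 1) ⟩
      + a ℤ.* (G 1 ℤ.+ 1ℤ) ℤ.+ + b ℤ.* 1ℤ
                      ≡⟨ cong (λ x → + a ℤ.* (G 1 ℤ.+ + x) ℤ.+ + b ℤ.* + x) s₀ ⟨
      + a ℤ.* (G 1 ℤ.+ + s 0) ℤ.+ + b ℤ.* + s 0
                      ≡⟨ cong (λ x → + a ℤ.* x ℤ.+ + b ℤ.* + s 0) (G-value 0) ⟩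
      + a ℤ.* + s 1 ℤ.+ + b ℤ.* + s 0 ≡⟨ s₂₊ℤ 0 ⟨
      + s 2 ∎
      where
      open ≡-Reasoning
      solve₁ : ∀ a b g → a ℤ.* g ℤ.+ b ℤ.* 1ℤ ℤ.+ a ≡ a ℤ.* (g ℤ.+ 1ℤ) ℤ.+ b ℤ.* 1ℤ
      solve₁ = solve-∀
    G-value (suc (suc n)) = begin
      G (3 + n) ℤ.+ + s (2 + n)
        ≡⟨ cong₂ ℤ._+_ (G-recurrence (1 + n)) (s₂₊ℤ n) ⟩
      + a ℤ.* G (2 + n) ℤ.+ + b ℤ.* G (1 + n) ℤ.+ (+ a ℤ.* + s (1 + n) ℤ.+ + b ℤ.* + s n)
        ≡⟨ collect (+ a) (+ b) (G (2 + n)) (G (1 + n)) (+ s (1 + n)) (+ s n) ⟩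
      + a ℤ.* (G (2 + n) ℤ.+ + s (1 + n)) ℤ.+ + b ℤ.* (G (1 + n) ℤ.+ + s n)
        ≡⟨ cong₂ (λ x y → + a ℤ.* x ℤ.+ + b ℤ.* y) (G-value (suc n)) (G-value n) ⟩
      + a ℤ.* + s (2 + n) ℤ.+ + b ℤ.* + s (1 + n)
        ≡⟨ s₂₊ℤ (1 + n) ⟨
      + s (3 + n) ∎
      where
      open ≡-Reasoning
      collect : ∀ a b g h s t → a ℤ.* g ℤ.+ b ℤ.* h ℤ.+ (a ℤ.* s ℤ.+ b ℤ.* t) ≡
        a ℤ.* (g ℤ.+ s) ℤ.+ b ℤ.* (h ℤ.+ t)
      collect = solve-∀

    F-value : ∀ n → + e n ≡ F n
    F-value zero          = cong +_ e₀
    F-value (suc zero)    = begin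
      + e 1                   ≡⟨ cancel (+ e 1) ⟩
      -1ℤ ℤ.+ (1ℤ ℤ.+ + e 1)  ≡⟨ cong (λ x → -1ℤ ℤ.+ + x) e₁ ⟩
      -1ℤ ℤ.+ + a             ≡⟨ G₁ ⟨
      -- On the antidiagonal `d + k = 1` both weights are 1.
      G 1                     ≡⟨ cong (ℤ._+_ -1ℤ) (ℤₚ.*-identityˡ (signed 0 1)) ⟨
      F 1                     ∎
      where
      open ≡-Reasoning
      cancel : ∀ x → x ≡ -1ℤ ℤ.+ (1ℤ ℤ.+ x)
      cancel = solve-∀
    -- Adding `s (1 + n)` to both sides turns the difference of consecutive `s` into `G (2 + n)`
    -- without subtracting.
    F-value (suc (suc n)) = +-cancel (+ s (1 + n)) _ _ (begin
      + e (2 + n) ℤ.+ + s (1 + n)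
        ≡⟨ e₂₊ℤ n ⟩
      + a ℤ.* + e (1 + n) ℤ.+ + b ℤ.* + e n ℤ.+ + s (2 + n)
        ≡⟨ cong₂ (λ x y → + a ℤ.* x ℤ.+ + b ℤ.* y ℤ.+ + s (2 + n)) (F-value (suc n)) (F-value n) ⟩
      + a ℤ.* F (1 + n) ℤ.+ + b ℤ.* F n ℤ.+ + s (2 + n)
        ≡⟨ cong (ℤ._+_ (+ a ℤ.* F (1 + n) ℤ.+ + b ℤ.* F n)) (G-value (1 + n)) ⟨
      + a ℤ.* F (1 + n) ℤ.+ + b ℤ.* F n ℤ.+ (G (2 + n) ℤ.+ + s (1 + n))
        ≡⟨ ℤₚ.+-assoc (+ a ℤ.* F (1 + n) ℤ.+ + b ℤ.* F n) (G (2 + n)) (+ s (1 + n)) ⟨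
      + a ℤ.* F (1 + n) ℤ.+ + b ℤ.* F n ℤ.+ G (2 + n) ℤ.+ + s (1 + n)
        ≡⟨ cong (ℤ._+ (+ s (1 + n))) (F-recurrence n) ⟨
      F (2 + n) ℤ.+ + s (1 + n) ∎)
      where open ≡-Reasoning

-- Counting edges between words

filter-map : ∀ {A B : Set} {P : Pred B 0ℓ} (P? : Decidable P) (f : A → B) xs →
  filter P? (map f xs) ≡ map f (filter (P? ∘ f) xs)
filter-map P? f []       = refl
filter-map P? f (x ∷ xs) with ih ← filter-map P? f xs | does (P? (f x))
... | true  = cong (f x ∷_) ih
... | false = ih

private variable
  m n k : ℕ

distance≡0⇒≡ : (x y : Word m n) → distance x y ≡ 0 → x ≡ y
distance≡0⇒≡ []       []       _   = refl
distance≡0⇒≡ (c ∷ cs) (d ∷ ds) d≡0 = cong₂ _∷_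
  (toℕ-injective (∣m-n∣≡0⇒m≡n (m+n≡0⇒m≡0 ∣ toℕ c - toℕ d ∣ d≡0)))
  (distance≡0⇒≡ cs ds (m+n≡0⇒n≡0 ∣ toℕ c - toℕ d ∣ d≡0))

sphere : ℕ → Word m n → List (Word m n) → ℕ
sphere r x ys = length (filter (λ y → distance x y ≟ r) ys)

-- Radius 1 counts edges between two blocks. Radius 0 counts coincidences, because distance 0 means
-- equality.
cross : ℕ → List (Word m n) → List (Word m n) → ℕ
cross r xs ys = sum (map (λ y → sphere r y xs) ys)

-- At the vertex list of a Horadam cube this is definitionally `numberOfEdges`; arbitrary lists are
-- allowed so that the list can be cut into blocks.
edgeCount : List (Word m n) → ℕ
edgeCount xs = length (filter (λ (x , y) → distance x y ≟ 1) (pairs xs))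

edgeCount-∷ : ∀ x (xs : List (Word m n)) → edgeCount (x ∷ xs) ≡ sphere 1 x xs + edgeCount xs
edgeCount-∷ x xs = trans (cong length (filter-++ adjacent? (map (x ,_) xs) (pairs xs)))
  (trans (length-++ (filter adjacent? (map (x ,_) xs)))
    (cong (_+ edgeCount xs) (trans (cong length (filter-map adjacent? (x ,_) xs))
      (length-map (x ,_) (filter (λ y → distance x y ≟ 1) xs)))))
  where
  adjacent? : Decidable (λ (x , y) → distance x y ≡ 1)
  adjacent? (x , y) = distance x y ≟ 1

sphere-++ : ∀ r (x : Word m n) xs ys → sphere r x (xs ++ ys) ≡ sphere r x xs + sphere r x ys
sphere-++ r x xs ys = trans (cong length (filter-++ (λ y → distance x y ≟ r) xs ys))
  (length-++ (filter (λ y → distance x y ≟ r) xs))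

cross-++ʳ : ∀ r (xs ys zs : List (Word m n)) → cross r xs (ys ++ zs) ≡ cross r xs ys + cross r xs zs
cross-++ʳ r xs ys zs = trans (cong sum (map-++ (λ y → sphere r y xs) ys zs))
  (sum-++ (map (λ y → sphere r y xs) ys) (map (λ y → sphere r y xs) zs))

cross-[]ˡ : ∀ r (ys : List (Word m n)) → cross r [] ys ≡ 0
cross-[]ˡ r []       = refl
cross-[]ˡ r (y ∷ ys) = cross-[]ˡ r ys

-- `cross` sums over its second list, so a new entry of the first is spread over all summands;
-- symmetry of the distance collects them into one sphere.
cross-∷ˡ : ∀ r x (xs ys : List (Word m n)) → cross r (x ∷ xs) ys ≡ sphere r x ys + cross r xs ys
cross-∷ˡ r x xs []       = refl
cross-∷ˡ r x xs (y ∷ ys)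
  rewrite cross-∷ˡ r x xs ys | distance-comm y x with does (distance x y ≟ r)
... | true  = cong suc (x∙yz≈y∙xz (sphere r y xs) (sphere r x ys) (cross r xs ys))
... | false = x∙yz≈y∙xz (sphere r y xs) (sphere r x ys) (cross r xs ys)

edgeCount-++ : ∀ (xs ys : List (Word m n)) →
  edgeCount (xs ++ ys) ≡ edgeCount xs + edgeCount ys + cross 1 xs ys
edgeCount-++ []       ys = sym (trans (cong (_+_ (edgeCount ys)) (cross-[]ˡ 1 ys)) (+-identityʳ _))
edgeCount-++ (x ∷ xs) ys = begin
  edgeCount (x ∷ xs ++ ys)
    ≡⟨ edgeCount-∷ x (xs ++ ys) ⟩
  sphere 1 x (xs ++ ys) + edgeCount (xs ++ ys)
    ≡⟨ cong₂ _+_ (sphere-++ 1 x xs ys) (edgeCount-++ xs ys) ⟩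
  (sphere 1 x xs + sphere 1 x ys) + (edgeCount xs + edgeCount ys + cross 1 xs ys)
    ≡⟨ rearrange (sphere 1 x xs) (sphere 1 x ys) (edgeCount xs) (edgeCount ys) _ ⟩
  (sphere 1 x xs + edgeCount xs) + edgeCount ys + (sphere 1 x ys + cross 1 xs ys)
    ≡⟨ cong₂ (λ i j → i + edgeCount ys + j) (edgeCount-∷ x xs) (cross-∷ˡ 1 x xs ys) ⟨
  edgeCount (x ∷ xs) + edgeCount ys + cross 1 (x ∷ xs) ys ∎
  where
  open ≡-Reasoning
  rearrange : ∀ i j k l p → (i + j) + (k + l + p) ≡ (i + k) + l + (j + p)
  rearrange = ℕ-Solver.solve-∀

-- The first letters add a fixed amount to every distance, which cancels against the radius. Equal
-- letters give edges inside a block, consecutive letters give pairs of equal tails.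
sphere-prefix : ∀ r (c d : Fin m) (x : Word m n) ys →
  sphere (∣ toℕ c - toℕ d ∣ + r) (c ∷ x) (map (d ∷_) ys) ≡ sphere r x ys
sphere-prefix r c d x ys = begin
  length (filter P? (map (d ∷_) ys))         ≡⟨ cong length (filter-map P? (d ∷_) ys) ⟩
  length (map (d ∷_) (filter (P? ∘ (d ∷_)) ys)) ≡⟨ length-map (d ∷_) (filter (P? ∘ (d ∷_)) ys) ⟩
  length (filter (P? ∘ (d ∷_)) ys)           ≡⟨ cong length (filter-≐ (P? ∘ (d ∷_)) (λ y → distance x y ≟ r)
                                                  (+-cancelˡ-≡ δ _ _ , cong (_+_ δ)) ys) ⟩
  sphere r x ys                              ∎
  where
  open ≡-Reasoning
  δ = ∣ toℕ c - toℕ d ∣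
  P? = λ y → distance (c ∷ x) y ≟ δ + r

sphere-far : ∀ (c d : Fin m) (x : Word m n) ys → 1 < ∣ toℕ c - toℕ d ∣ →
  sphere 1 (c ∷ x) (map (d ∷_) ys) ≡ 0
sphere-far c d x ys 1<δ = cong length (trans (filter-map P? (d ∷_) ys)
  (cong (map (d ∷_)) (filter-none (P? ∘ (d ∷_)) (All.universal far ys))))
  where
  P? = λ y → distance (c ∷ x) y ≟ 1
  far : ∀ y → distance (c ∷ x) (d ∷ y) ≢ 1
  far y = >⇒≢ (m≤n⇒m≤n+o (distance x y) 1<δ)

edgeCount-prefix : ∀ (c : Fin m) (xs : List (Word m n)) →
  edgeCount (map (c ∷_) xs) ≡ edgeCount xs
edgeCount-prefix c []       = refl
edgeCount-prefix c (x ∷ xs) = begin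
  edgeCount (map (c ∷_) (x ∷ xs))
    ≡⟨ edgeCount-∷ (c ∷ x) (map (c ∷_) xs) ⟩
  sphere 1 (c ∷ x) (map (c ∷_) xs) + edgeCount (map (c ∷_) xs)
    ≡⟨ cong₂ _+_
         (subst (λ δ → sphere (δ + 1) (c ∷ x) (map (c ∷_) xs) ≡ sphere 1 x xs)
           (∣n-n∣≡0 (toℕ c)) (sphere-prefix 1 c c x xs))
         (edgeCount-prefix c xs) ⟩
  sphere 1 x xs + edgeCount xs
    ≡⟨ edgeCount-∷ x xs ⟨
  edgeCount (x ∷ xs) ∎
  where open ≡-Reasoning

cross-consecutive : ∀ (c d : Fin m) (xs ys : List (Word m n)) → ∣ toℕ d - toℕ c ∣ ≡ 1 →
  cross 1 (map (c ∷_) xs) (map (d ∷_) ys) ≡ cross 0 xs ys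
cross-consecutive c d xs ys δ≡1 = cong sum (trans (sym (map-∘ ys)) (map-cong step ys))
  where
  step : ∀ y → sphere 1 (d ∷ y) (map (c ∷_) xs) ≡ sphere 0 y xs
  step y = subst (λ δ → sphere (δ + 0) (d ∷ y) (map (c ∷_) xs) ≡ sphere 0 y xs)
    δ≡1 (sphere-prefix 0 d c y xs)

cross-far : ∀ (c d : Fin m) (xs ys : List (Word m n)) → 1 < ∣ toℕ d - toℕ c ∣ →
  cross 1 (map (c ∷_) xs) (map (d ∷_) ys) ≡ 0
cross-far c d xs []       1<δ = refl
cross-far c d xs (y ∷ ys) 1<δ = cong₂ _+_ (sphere-far d c y xs 1<δ) (cross-far c d xs ys 1<δ)

sphere-0 : ∀ (x : Word m n) {xs} → Unique xs → x ∈ xs → sphere 0 x xs ≡ 1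
sphere-0 x {y ∷ xs} (y∉xs ∷ _) (here refl) = cong length (trans
  (filter-accept (λ z → distance x z ≟ 0) (distance-self x))
  (cong (x ∷_) (filter-none (λ z → distance x z ≟ 0)
    (All.map (λ x≢z d≡0 → x≢z (distance≡0⇒≡ x _ d≡0)) y∉xs))))
sphere-0 x {y ∷ xs} (y∉xs ∷ xs!) (there x∈xs) = trans
  (cong length (filter-reject (λ z → distance x z ≟ 0)
    (λ d≡0 → All.lookup y∉xs x∈xs (sym (distance≡0⇒≡ x y d≡0)))))
  (sphere-0 x xs! x∈xs)

-- Each entry of `ys` meets its only copy in `xs`. Applied to `S` inside `T`, and to `S` inside
-- itself.
cross-0 : ∀ {xs : List (Word m n)} → Unique xs → ∀ {ys} → All (_∈ xs) ys → cross 0 xs ys ≡ length ys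
cross-0 xs! []            = refl
cross-0 xs! (y∈xs ∷ ys∈xs) = cong₂ _+_ (sphere-0 _ xs! y∈xs) (cross-0 xs! ys∈xs)

-- Lists of words grouped by first letter

blocks : ∀ k → (Fin k → Fin m) → (Fin k → List (Word m n)) → List (Word m (suc n))
blocks zero    f L = []
blocks (suc k) f L = map (f zero ∷_) (L zero) ++ blocks k (f ∘ suc) (L ∘ suc)

filter-blocks : ∀ {P : Pred (Word m (suc n)) 0ℓ} (P? : Decidable P) k (f : Fin k → Fin m) ws →
  filter P? (cartesianProductWith _∷_ (tabulate f) ws) ≡
    blocks k f (λ i → filter (P? ∘ (f i ∷_)) ws)
filter-blocks P? zero    f ws = refl
filter-blocks P? (suc k) f ws = trans (filter-++ P? (map (f zero ∷_) ws) _)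
  (cong₂ _++_ (filter-map P? (f zero ∷_) ws) (filter-blocks P? k (f ∘ suc) ws))

blocks-[] : ∀ k (f : Fin k → Fin m) (L : Fin k → List (Word m n)) →
  (∀ i → L i ≡ []) → blocks k f L ≡ []
blocks-[] zero    f L L≡[] = refl
blocks-[] (suc k) f L L≡[] =
  cong₂ (λ xs ys → map (f zero ∷_) xs ++ ys) (L≡[] zero) (blocks-[] k (f ∘ suc) (L ∘ suc) (L≡[] ∘ suc))

blocks-far : ∀ k (f : Fin k → Fin m) (L : Fin k → List (Word m n)) c xs →
  (∀ i → 1 < ∣ toℕ (f i) - toℕ c ∣) → cross 1 (map (c ∷_) xs) (blocks k f L) ≡ 0
blocks-far zero    f L c xs far = refl
blocks-far (suc k) f L c xs far = trans
  (cross-++ʳ 1 (map (c ∷_) xs) (map (f zero ∷_) (L zero)) _)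
  (cong₂ _+_ (cross-far c (f zero) xs (L zero) (far zero))
    (blocks-far k (f ∘ suc) (L ∘ suc) c xs (far ∘ suc)))

-- The first `p` letters all allow the same tails and the later letters allow none. For Horadam
-- words, the nonzero letters follow this pattern, with `p` depending on whether a 0 precedes.
record Run (p : ℕ) (S : List (Word m n)) (L : Fin k → List (Word m n)) : Set where
  field
    inside  : ∀ i → toℕ i < p → L i ≡ S
    outside : ∀ i → p ≤ toℕ i → L i ≡ []

open Run

Run-suc : ∀ {p} {S : List (Word m n)} {L : Fin (suc k) → List (Word m n)} →
  Run (suc p) S L → Run p S (L ∘ suc)
Run-suc run .inside  i i<p = inside  run (suc i) (s≤s i<p)
Run-suc run .outside i p≤i = outside run (suc i) (s≤s p≤i)

length-blocks : ∀ k p (f : Fin k → Fin m) {S : List (Word m n)} {L} → p ≤ k → Run p S L →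
  length (blocks k f L) ≡ p * length S
length-blocks k       zero    f p≤k       run =
  cong length (blocks-[] k f _ λ i → outside run i z≤n)
length-blocks (suc k) (suc p) f {S} {L} (s≤s p≤k) run = trans
  (length-++ (map (f zero ∷_) (L zero)))
  (cong₂ _+_ (trans (length-map (f zero ∷_) (L zero)) (cong length (inside run zero z<s)))
    (length-blocks k p (f ∘ suc) p≤k (Run-suc run)))

-- Counting the edges to the preceding block `c` as well makes every step alike: a block brings its
-- inner edges and one edge per tail to its predecessor. The predecessor enters only through its
-- overlap with `S`, since the very first one has the tails `T`.
edgeCount-blocks : ∀ k p (f : Fin k → Fin m) {S : List (Word m n)} {L} c xs →
  p ≤ k → Run p S L → (∀ i → toℕ (f i) ≡ suc (toℕ i + toℕ c)) →
  Unique S → cross 0 xs S ≡ length S →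
  edgeCount (blocks k f L) + cross 1 (map (c ∷_) xs) (blocks k f L) ≡ p * (length S + edgeCount S)
edgeCount-blocks k zero f {S} {L} c xs p≤k run f≡ S! S⊆xs
  rewrite blocks-[] k f L (λ i → outside run i z≤n) = refl
edgeCount-blocks (suc k) (suc p) f {S} {L} c xs (s≤s p≤k) run f≡ S! S⊆xs = begin
  edgeCount (B₀ ++ B) + cross 1 (map (c ∷_) xs) (B₀ ++ B)
    ≡⟨ cong₂ _+_ (edgeCount-++ B₀ B) (cross-++ʳ 1 (map (c ∷_) xs) B₀ B) ⟩
  (edgeCount B₀ + edgeCount B + cross 1 B₀ B) +
    (cross 1 (map (c ∷_) xs) B₀ + cross 1 (map (c ∷_) xs) B)
    ≡⟨ cong₂ (λ i j → (edgeCount B₀ + edgeCount B + cross 1 B₀ B) + (i + j)) first far ⟩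
  (edgeCount B₀ + edgeCount B + cross 1 B₀ B) + (length S + 0)
    ≡⟨ rearrange (edgeCount B₀) (edgeCount B) _ (length S) ⟩
  (length S + edgeCount B₀) + (edgeCount B + cross 1 B₀ B)
    ≡⟨ cong₂ (λ i j → (length S + i) + j)
         (trans (edgeCount-prefix (f zero) (L zero)) (cong edgeCount L₀≡S)) rest ⟩
  (length S + edgeCount S) + p * (length S + edgeCount S) ∎
  where
  open ≡-Reasoning
  B₀ = map (f zero ∷_) (L zero)
  B  = blocks k (f ∘ suc) (L ∘ suc)
  L₀≡S = inside run zero z<s
  rearrange : ∀ i j k l → (i + j + k) + (l + 0) ≡ (l + i) + (j + k)
  rearrange = ℕ-Solver.solve-∀
  gap : ∀ i → ∣ toℕ (f i) - toℕ c ∣ ≡ suc (toℕ i)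
  gap i = trans (cong (λ t → ∣ t - toℕ c ∣) (trans (f≡ i) (+-comm (suc (toℕ i)) (toℕ c))))
    (trans (∣-∣-comm (toℕ c + suc (toℕ i)) (toℕ c)) (∣m-m+n∣≡n (toℕ c) (suc (toℕ i))))
  first : cross 1 (map (c ∷_) xs) B₀ ≡ length S
  first = trans (cross-consecutive c (f zero) xs (L zero) (gap zero))
    (trans (cong (cross 0 xs) L₀≡S) S⊆xs)
  -- All later first letters differ from `c` by at least 2.
  far : cross 1 (map (c ∷_) xs) B ≡ 0
  far = blocks-far k (f ∘ suc) (L ∘ suc) c xs
    (λ i → subst (1 <_) (sym (gap (suc i))) (s≤s (s≤s z≤n)))
  f-suc : ∀ i → toℕ (f (suc i)) ≡ suc (toℕ i + toℕ (f zero))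
  f-suc i rewrite f≡ (suc i) | f≡ zero = cong suc (sym (+-suc (toℕ i) (toℕ c)))
  rest : edgeCount B + cross 1 B₀ B ≡ p * (length S + edgeCount S)
  -- The block just removed becomes the predecessor; its tails are `S`, so the overlap is all of
  -- `S`.
  rest = edgeCount-blocks k p (f ∘ suc) (f zero) (L zero) p≤k (Run-suc run) f-suc S!
    (trans (cong (λ xs → cross 0 xs S) L₀≡S) (cross-0 S! (All.tabulate id)))

-- Horadam words

module _ (a′ b : ℕ) where

  private
    -- As a successor, `a` makes 0 the constructor `zero`; the other unrestricted letters are
    -- `suc c` with `toℕ c < a′`.
    a = suc a′

  Horadam : (n : ℕ) → Pred (Word (a + b) n) _
  Horadam n = IsHoradam a b n

  AfterZero : (n : ℕ) → Pred (Word (a + b) n) _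
  AfterZero n cs = Horadam (suc n) (zero ∷ cs)

  -- Only positions with a letter of size at least `a` impose a condition, so the leading zeros
  -- impose none, and the first letter of the tail follows a 0 on either side.
  AfterZero-zero : (λ cs → AfterZero (suc n) (zero ∷ cs)) ≐ AfterZero n
  AfterZero-zero = to , from
    where
    to : (λ cs → AfterZero (suc n) (zero ∷ cs)) ⊆ AfterZero n
    to h (suc i) a≤c with h (suc (suc i)) a≤c
    ... | suc j , j≡ , xⱼ≡0 = j , suc-injective j≡ , xⱼ≡0
    from : AfterZero n ⊆ (λ cs → AfterZero (suc n) (zero ∷ cs))
    from h (suc (suc i)) a≤c with h (suc i) a≤c
    ... | j , j≡ , xⱼ≡0 = suc j , cong suc j≡ , xⱼ≡0

  -- The leading 0 permits any letter after it, but a nonzero letter gives no such permission to the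
  -- tail.
  AfterZero-suc : ∀ {c} → (λ cs → AfterZero (suc n) (suc c ∷ cs)) ≐ Horadam n
  AfterZero-suc {n} {c} = to , from
    where
    to : (λ cs → AfterZero (suc n) (suc c ∷ cs)) ⊆ Horadam n
    to h i a≤c with h (suc (suc i)) a≤c
    ... | suc (suc j) , j≡ , xⱼ≡0 = j , suc-injective (suc-injective j≡) , xⱼ≡0
    from : Horadam n ⊆ (λ cs → AfterZero (suc n) (suc c ∷ cs))
    from h (suc zero)    a≤c = zero , refl , refl
    from h (suc (suc i)) a≤c with h i a≤c
    ... | j , j≡ , xⱼ≡0 = suc (suc j) , cong suc (cong suc j≡) , xⱼ≡0

  Horadam-suc : ∀ {c} → toℕ c < a′ → (λ cs → Horadam (suc n) (suc c ∷ cs)) ≐ Horadam n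
  Horadam-suc {n} {c} c<a′ = to , from
    where
    to : (λ cs → Horadam (suc n) (suc c ∷ cs)) ⊆ Horadam n
    to h i a≤c with h (suc i) a≤c
    ... | suc j , j≡ , xⱼ≡0 = j , suc-injective j≡ , xⱼ≡0
    from : Horadam n ⊆ (λ cs → Horadam (suc n) (suc c ∷ cs))
    from h zero    a≤c = contradiction a≤c (<⇒≱ (s≤s c<a′))
    from h (suc i) a≤c with h i a≤c
    ... | j , j≡ , xⱼ≡0 = suc j , cong suc j≡ , xⱼ≡0

  -- The first position has no predecessor that could carry the required 0.
  ¬Horadam-suc : ∀ {c} → a′ ≤ toℕ c → ∀ cs → ¬ Horadam (suc n) (suc c ∷ cs)
  ¬Horadam-suc a′≤c cs h with h zero (s≤s a′≤c)
  ... | _ , () , _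

  Horadam⊆AfterZero : Horadam n ⊆ AfterZero n
  Horadam⊆AfterZero h (suc i) a≤c with h i a≤c
  ... | j , j≡ , xⱼ≡0 = suc j , cong suc j≡ , xⱼ≡0

  S T : (n : ℕ) → List (Word (a + b) n)
  S n = filter (isHoradam? a b n) (words (a + b) n)
  T n = filter (λ cs → isHoradam? a b (suc n) (zero ∷ cs)) (words (a + b) n)

  S! : ∀ n → Unique (S n)
  S! n = filter⁺ (isHoradam? a b n) (words-unique (a + b) n)

  T! : ∀ n → Unique (T n)
  T! n = filter⁺ (λ cs → isHoradam? a b (suc n) (zero ∷ cs)) (words-unique (a + b) n)

  S⊆T : ∀ n → All (_∈ T n) (S n)
  S⊆T n = All.tabulate λ x∈S →
    let x∈W , h = ∈-filter⁻ (isHoradam? a b n) {xs = words (a + b) n} x∈S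
    in ∈-filter⁺ (λ cs → isHoradam? a b (suc n) (zero ∷ cs)) x∈W (Horadam⊆AfterZero h)

  -- Common shape of `S (suc n)` and `T (suc n)`, which differ only in the number `p` of admissible
  -- nonzero first letters; both are thus counted at once.
  record Layer (p : ℕ) (xs : List (Word (a + b) (suc n))) : Set where
    field
      rest  : Fin (a′ + b) → List (Word (a + b) n)
      xs≡   : xs ≡ map (zero ∷_) (T n) ++ blocks (a′ + b) suc rest
      p≤    : p ≤ a′ + b
      run   : Run p (S n) rest

  open Layer

  S-layer : ∀ n → Layer a′ (S (suc n))
  S-layer n .rest i = filter (λ cs → isHoradam? a b (suc n) (suc i ∷ cs)) (words (a + b) n)
  S-layer n .xs≡    = filter-blocks (isHoradam? a b (suc n)) (a + b) id (words (a + b) n)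
  S-layer n .p≤     = m≤m+n a′ b
  S-layer n .run .Run.inside  i i<a′ =
    filter-≐ (λ cs → isHoradam? a b (suc n) (suc i ∷ cs)) (isHoradam? a b n)
      (Horadam-suc i<a′) (words (a + b) n)
  S-layer n .run .Run.outside i a′≤i =
    filter-none (λ cs → isHoradam? a b (suc n) (suc i ∷ cs))
      (All.universal (¬Horadam-suc a′≤i) (words (a + b) n))

  T-layer : ∀ n → Layer (a′ + b) (T (suc n))
  T-layer n .rest i = filter (λ cs → isHoradam? a b (2 + n) (zero ∷ suc i ∷ cs)) (words (a + b) n)
  T-layer n .xs≡    = trans
    (filter-blocks (λ cs → isHoradam? a b (2 + n) (zero ∷ cs)) (a + b) id (words (a + b) n))
    (cong (λ xs → map (zero ∷_) xs ++ blocks (a′ + b) suc (T-layer n .rest))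
      (filter-≐ (λ cs → isHoradam? a b (2 + n) (zero ∷ zero ∷ cs))
        (λ cs → isHoradam? a b (suc n) (zero ∷ cs)) AfterZero-zero (words (a + b) n)))
  T-layer n .p≤     = ≤-refl
  T-layer n .run .Run.inside  i _ =
    filter-≐ (λ cs → isHoradam? a b (2 + n) (zero ∷ suc i ∷ cs)) (isHoradam? a b n)
      AfterZero-suc (words (a + b) n)
  T-layer n .run .Run.outside i a′+b≤i = contradiction a′+b≤i (<⇒≱ (toℕ<n i))

  length-layer : ∀ {p} {xs : List (Word (a + b) (suc n))} → Layer p xs →
    length xs ≡ length (T n) + p * length (S n)
  length-layer {n} {p} layer = trans (cong length (layer .xs≡))
    (trans (length-++ (map (zero ∷_) (T n)))
      (cong₂ _+_ (length-map (zero ∷_) (T n))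
        (length-blocks (a′ + b) p suc (layer .p≤) (layer .run))))

  edgeCount-layer : ∀ {p} {xs : List (Word (a + b) (suc n))} → Layer p xs →
    edgeCount xs ≡ edgeCount (T n) + p * (length (S n) + edgeCount (S n))
  edgeCount-layer {n} {p} {xs} layer = begin
    edgeCount xs                 ≡⟨ cong edgeCount (layer .xs≡) ⟩
    edgeCount (T₀ ++ B)          ≡⟨ edgeCount-++ T₀ B ⟩
    edgeCount T₀ + edgeCount B + cross 1 T₀ B
                                 ≡⟨ +-assoc (edgeCount T₀) (edgeCount B) _ ⟩
    edgeCount T₀ + (edgeCount B + cross 1 T₀ B)
                                 ≡⟨ cong₂ _+_ (edgeCount-prefix zero (T n))
                                      (edgeCount-blocks (a′ + b) p suc zero (T n)
                                        (layer .p≤) (layer .run)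
                                        (λ i → cong suc (sym (+-identityʳ (toℕ i))))
                                        (S! n) (cross-0 (T! n) (S⊆T n))) ⟩
    edgeCount (T n) + p * (length (S n) + edgeCount (S n)) ∎
    where
    open ≡-Reasoning
    T₀ = map (zero ∷_) (T n)
    B  = blocks (a′ + b) suc (layer .rest)

  -- Recurrences for the numbers of vertices and edges

  s e : ℕ → ℕ
  s n = length (S n)
  e n = edgeCount (S n)

  S₀ : S 0 ≡ [] ∷ []
  S₀ = filter-accept (isHoradam? a b 0) {x = []} {xs = []} λ ()

  T₀ : T 0 ≡ [] ∷ []
  T₀ = filter-accept (λ cs → isHoradam? a b 1 (zero ∷ cs)) {x = []} {xs = []} λ { zero () }

  s₁ : s 1 ≡ a
  s₁ = trans (length-layer (S-layer 0))
    (trans (cong₂ (λ xs ys → length xs + a′ * length ys) T₀ S₀) (cong suc (*-identityʳ a′)))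

  -- The cube of dimension 1 is the path on the letters below `a`.
  e₁ : 1 + e 1 ≡ a
  e₁ = cong suc (trans (edgeCount-layer (S-layer 0))
    (trans (cong₂ (λ xs ys → edgeCount xs + a′ * (length ys + edgeCount ys)) T₀ S₀)
      (*-identityʳ a′)))

  -- `T (suc n)` exceeds `S (suc n)` by one copy of `S n` for each of the `b` restricted letters,
  -- which eliminates `T`.
  s₂₊ : ∀ n → s (2 + n) ≡ a * s (1 + n) + b * s n
  s₂₊ n rewrite length-layer (S-layer (suc n)) | length-layer (S-layer n) | length-layer (T-layer n) =
    identity a′ b (length (T n)) (s n)
    where
    identity : ∀ a′ b t s → (t + (a′ + b) * s) + a′ * (t + a′ * s) ≡
      (1 + a′) * (t + a′ * s) + b * s
    identity = ℕ-Solver.solve-∀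

  -- Eliminating `T` as for `s₂₊` leaves the extra edges `b * s n + a′ * s (1 + n)`, which by `s₂₊`
  -- is the difference of `s (2 + n)` and `s (1 + n)`.
  e₂₊ : ∀ n → e (2 + n) + s (1 + n) ≡ a * e (1 + n) + b * e n + s (2 + n)
  e₂₊ n rewrite edgeCount-layer (S-layer (suc n)) | edgeCount-layer (S-layer n)
    | edgeCount-layer (T-layer n) | s₂₊ n =
    identity a′ b (edgeCount (T n)) (s n) (e n) (s (1 + n))
    where
    identity : ∀ a′ b t s e s₁ →
      (t + (a′ + b) * (s + e)) + a′ * (s₁ + (t + a′ * (s + e))) + s₁ ≡
      (1 + a′) * (t + a′ * (s + e)) + b * e + ((1 + a′) * s₁ + b * s)
    identity = ℕ-Solver.solve-∀

theorem5 : ∀ (a b n : ℕ) → 1 ≤ a → 1 ≤ b →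
    + numberOfEdges (horadamCube a b n) ≡
    ∑[0⋯ n ] (λ k →
    (-1ℤ ℤ.^ (n ∸ k)) ℤ.* (+ (⌈ n + k /2⌉ * (⌊ n + k /2⌋ C k) * a ^ k * b ^ ⌊ n ∸ k /2⌋)))
theorem5 (suc a′) b n _ _ = trans
  (Coefficients.F-value (suc a′) b (s a′ b) (e a′ b) (cong length (S₀ a′ b)) (s₁ a′ b)
    (cong edgeCount (S₀ a′ b)) (e₁ a′ b) (s₂₊ a′ b) (e₂₊ a′ b) n)
  (sym (Coefficients.∑≡F (suc a′) b n))
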